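{- Let $\sigma$ be a finite nonempty signature of atoms. The class $\mathcal P^\sigma[\mathsf U]$ of peerless queries is polynomially characterisable within $\mathcal Q_p^\sigma[\mathsf U]$; that is, there is a polynomial $f$ such that every $q\in\mathcal P^\sigma[\mathsf U]$ is uniquely characterised within $\mathcal Q_p^\sigma[\mathsf U]$ by some example set $E$ with $|E|\le f(|q|)$.
   Context: A $\sigma$-data instance is a finite sequence $\mathcal D=(\delta_0,\dots,\delta_n)$ with $\delta_i\subseteq\sigma$, identified with its extensions by trailing $\emptyset$'s (so $\delta_\ell=\emptyset$ for $\ell>n$); $|\mathcal D|=\sum_i|\delta_i|$. Semantics at $\ell\in\mathbb N$: $\mathcal D,\ell\models A$ iff $A\in\delta_\ell$; $\mathcal D,\ell\models\top$; $\mathcal D,\ell\not\models\bot$; conjunction as usual; $\mathcal D,\ell\models q_1\mathbin{\mathsf U}q_2$ iff there is $m>\ell$ with $\mathcal D,m\models q_2$ and $\mathcal D,k\models q_1$ for all $k$ with $\ell<k<m$. Queries $q,q'$ are equivalent ($q\equiv q'$) if they are true at the same $(\mathcal D,\ell)$. $|q|$ is the number of symbols in $q$. $\mathcal Q_p^\sigma[\mathsf U]$ is the class of queries $$q=\rho_0\wedge(\lambda_1\mathbin{\mathsf U}(\rho_1\wedge(\lambda_2\mathbin{\mathsf U}(\dots(\lambda_n\mathbin{\mathsf U}\rho_n)\dots)))),\qquad n\ge0,$$ where each $\rho_i$ is a (possibly empty) conjunction of atoms from $\sigma$ and each $\lambda_i$ is either $\bot$ or a (possibly empty) conjunction of atoms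 from $\sigma$; conjunctions are identified with subsets of $\sigma$, the empty conjunction being $\top$. Such a query is peerless if for every $i\in\{1,\dots,n\}$ either $\lambda_i=\bot$ or the sets $\lambda_i$ and $\rho_i$ are incomparable with respect to $\subseteq$; $\mathcal P^\sigma[\mathsf U]$ is the class of peerless queries in $\mathcal Q_p^\sigma[\mathsf U]$. An example set is a pair $E=(E^+,E^-)$ of finite sets of $\sigma$-data instances, $|E|=\sum_{\mathcal D\in E^+\cup E^- }|\mathcal D|$. A query $q$ fits $E$ if $\mathcal D,0\models q$ for all $\mathcal D\in E^+$ and $\mathcal D,0\not\models q$ for all $\mathcal D\in E^-$. $E$ uniquely characterises $q$ within a class $\mathcal Q$ if $q$ fits $E$ and $q\equiv q'$ for all $q'\in\mathcal Q$ that fit $E$. -}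

module Defs where

open import Data.Empty using (⊥)
open import Data.Fin using (Fin)
open import Data.Fin.Subset using (Subset; _∈_; _⊆_; ∣_∣) renaming (⊥ to ∅)
open import Data.Fin.Subset.Properties using (_∈?_)
open import Data.List using (List; []; _∷_; allFin; filter; foldr; map; sum)
open import Data.List.Relation.Unary.All using (All)
open import Data.Nat using (ℕ; zero; suc; _+_; _*_; _<_; _≤_)
open import Data.Product using (Σ-syntax; ∃-syntax; _×_)
open import Data.Unit using (⊤)
open import Function.Bundles using (_⇔_)
open import Relation.Binary.PropositionalEquality using (_≡_)
open import Relation.Nullary using (¬_)

-- A finite signature with s atoms is represented by Fin s.
variable
  s : ℕ

------------------------------------------------------------------------
-- Data instances

-- Instances are identified with their extensions by trailing ∅'s, so the
-- empty list is just another presentation of the one-element sequence (∅).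
-- Neither _at_ nor ∥_∥ᴵ distinguishes presentations of the same instance.
Instance : ℕ → Set
Instance s = List (Subset s)

infix 8 _at_

_at_ : Instance s → ℕ → Subset s
[]      at _     = ∅
(δ ∷ _) at zero  = δ
(_ ∷ D) at suc ℓ = D at ℓ

∥_∥ᴵ : Instance s → ℕ
∥ D ∥ᴵ = sum (map ∣_∣ D)

------------------------------------------------------------------------
-- Queries

infixr 6 _∧_
infixr 7 _U_

data Query (s : ℕ) : Set where
  atom    : Fin s → Query s
  `⊤ `⊥   : Query s
  _∧_ _U_ : Query s → Query s → Query s

infix 4 _,_⊨_ _≣_

-- The until operator is strict: nothing is required at ℓ itself.
_,_⊨_ : Instance s → ℕ → Query s → Set
D , ℓ ⊨ atom A  = A ∈ D at ℓ
D , ℓ ⊨ `⊤      = ⊤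
D , ℓ ⊨ `⊥      = ⊥
D , ℓ ⊨ q₁ ∧ q₂ = (D , ℓ ⊨ q₁) × (D , ℓ ⊨ q₂)
D , ℓ ⊨ q₁ U q₂ = ∃[ m ] ℓ < m × (D , m ⊨ q₂) × (∀ k → ℓ < k → k < m → D , k ⊨ q₁)

_≣_ : Query s → Query s → Set
q ≣ q′ = ∀ D ℓ → (D , ℓ ⊨ q) ⇔ (D , ℓ ⊨ q′)

-- Number of symbols: occurrences of atoms, constants and connectives
-- (parentheses are not counted).
∥_∥ : Query s → ℕ
∥ atom _ ∥  = 1
∥ `⊤ ∥      = 1
∥ `⊥ ∥      = 1
∥ q₁ ∧ q₂ ∥ = suc (∥ q₁ ∥ + ∥ q₂ ∥)
∥ q₁ U q₂ ∥ = suc (∥ q₁ ∥ + ∥ q₂ ∥)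

------------------------------------------------------------------------
-- Path queries

-- The conjunction of the listed atoms; ⊤ only stands for the empty one.
⋀ : List (Fin s) → Query s
⋀ []           = `⊤
⋀ (A ∷ [])     = atom A
⋀ (A ∷ B ∷ As) = atom A ∧ ⋀ (B ∷ As)

conjunction : Subset s → Query s
conjunction ρ = ⋀ (filter (_∈? ρ) (allFin _))

data Guard (s : ℕ) : Set where
  bot  : Guard s
  conj : Subset s → Guard s

guard : Guard s → Query s
guard bot       = `⊥
guard (conj λ′) = conjunction λ′

-- end ρₙ is the path ρₙ, and step ρ λ′ p is ρ ∧ (λ′ U p).
data Path (s : ℕ) : Set where
  end  : Subset s → Path s
  step : Subset s → Guard s → Path s → Path s

query : Path s → Query s
query (end ρ)       = conjunction ρ
query (step ρ λ′ p) = conjunction ρ ∧ (guard λ′ U query p)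

head : Path s → Subset s
head (end ρ)      = ρ
head (step ρ _ _) = ρ

Incomparable : Subset s → Subset s → Set
Incomparable X Y = ¬ (X ⊆ Y) × ¬ (Y ⊆ X)

PeerlessGuard : Guard s → Subset s → Set
PeerlessGuard bot       ρ = ⊤
PeerlessGuard (conj λ′) ρ = Incomparable λ′ ρ

-- In step ρ λ′ p, the guard λ′ = λᵢ is compared with ρᵢ, the head of p.
PeerlessPath : Path s → Set
PeerlessPath (end _)       = ⊤
PeerlessPath (step _ λ′ p) = PeerlessGuard λ′ (head p) × PeerlessPath p

QueryClass : ℕ → Set₁
QueryClass s = Query s → Set

𝒬ₚ[U] : (s : ℕ) → QueryClass s
𝒬ₚ[U] s q = ∃[ p ] q ≡ query {s} p

𝒫[U] : (s : ℕ) → QueryClass s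
𝒫[U] s q = Σ[ p ∈ Path s ] PeerlessPath p × q ≡ query p

------------------------------------------------------------------------
-- Example sets and characterisability

-- Finite sets of instances are given by listing their elements.
record ExampleSet (s : ℕ) : Set where
  field
    E⁺ E⁻ : List (Instance s)

open ExampleSet public

-- Repeated elements are counted with multiplicity, so this is an upper bound
-- on the size of E⁺ ∪ E⁻, attained by repetition-free lists with E⁺ and E⁻
-- disjoint (as they must be whenever some query fits E).
∥_∥ᴱ : ExampleSet s → ℕ
∥ E ∥ᴱ = sum (map ∥_∥ᴵ (E⁺ E)) + sum (map ∥_∥ᴵ (E⁻ E))

Fits : Query s → ExampleSet s → Set
Fits q E = All (λ D → D , 0 ⊨ q) (E⁺ E) × All (λ D → ¬ (D , 0 ⊨ q)) (E⁻ E)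

UniquelyCharacterises : ExampleSet s → Query s → QueryClass s → Set
UniquelyCharacterises E q 𝒬 = Fits q E × (∀ q′ → 𝒬 q′ → Fits q′ E → q ≣ q′)

-- Polynomials are lists of coefficients, constant term first.  Natural
-- coefficients suffice for upper bounds on ℕ.
Polynomial : Set
Polynomial = List ℕ

eval : Polynomial → ℕ → ℕ
eval f x = foldr (λ c r → c + x * r) 0 f

PolynomiallyCharacterisable : QueryClass s → QueryClass s → Set
PolynomiallyCharacterisable {s} 𝒫 𝒬 =
  Σ[ f ∈ Polynomial ] (∀ q → 𝒫 q →
    Σ[ E ∈ ExampleSet s ] UniquelyCharacterises E q 𝒬 × ∥ E ∥ᴱ ≤ eval f ∥ q ∥)

{-# OPTIONS --safe #-}
module Submission where

-- Write L(t) for the words matched by t = (λ₁,ρ₁) … (λₙ,ρₙ).  Since λᵢ and ρᵢ are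
-- incomparable, t reads ρ₁ … ρᵢ w only by advancing at each ρⱼ, so words that differ from
-- ρ₁ … ρₙ from position i on test the i-th suffix of t.  Let t′ agree with t on the examples.
-- The words σⁱ X σⁿ⁻ⁱ force t′ to have the same length and the same sets ρᵢ.
--
-- L(t) ⊆ L(t′): follow a run of t′ on the word in which each λᵢ ≠ ⊥ occurs once before ρᵢ.
-- If the run falls behind at i, so λ′ᵢ ⊆ ρᵢ, then ρᵢ = ρᵢ₊₁ = … = ρₖ₋₁ = λₖ for the next
-- k > i with λₖ ≠ ⊥, and the run has caught up when it reaches ρₖ: t′ has just moved the
-- loop on this set from the end of the block to its beginning.
--
-- L(t′) ⊆ L(t): let r be the suffix of t after i.  If λᵢ is not contained in λ′ᵢ ≠ ⊥, then
-- ρᵢ ⊆ λ′ᵢ and it suffices that ρᵢ L(r) ⊆ L(r).  This no longer involves t′, and it can be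
-- tested on one word of L(r), a counterexample of quadratic length if there is any.

open import Defs
open import Data.Bool using (true; false)
open import Data.Empty using (⊥-elim)
open import Data.Fin using (Fin)
open import Data.Fin.Subset using (Subset; _⊆_; _∈_; Nonempty) renaming (⊤ to ⊤ˢ; ⊥ to ∅)
open import Data.Fin.Subset.Properties using (_∈?_; _⊆?_; ⊆-antisym; ⊆⊤; ∉⊥; nonempty?; ∣p∣≤n)
open import Data.List using (List; []; _∷_; _++_; _∷ʳ_; allFin; drop; filter; length; map; replicate)
open import Data.List.Membership.Propositional using () renaming (_∈_ to _∈ˡ_)
open import Data.List.Membership.Propositional.Properties
  using (∈-map⁺; ∈-map⁻; ∈-++⁺ˡ; ∈-++⁺ʳ; ∈-++⁻; ∈-filter⁺; ∈-filter⁻; ∈-allFin)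
open import Data.List.Properties
  using (++-identityʳ; ∷ʳ-++; length-++; length-map; length-replicate; length-filter)
open import Data.List.Relation.Binary.Pointwise as Pointwise using (Pointwise; []; _∷_)
open import Data.List.Relation.Unary.All as All using (All; []; _∷_)
open import Data.List.Relation.Unary.Any using (here; there)
open import Data.Nat using (ℕ; zero; suc; _+_; _*_; _≤_; _<_; NonZero; z≤n; s≤s; s≤s⁻¹; >-nonZero)
open import Data.Nat.ListAction using (sum)
open import Data.Nat.Properties
  using (≤-refl; ≤-reflexive; ≤-trans; ≤-antisym; <-irrefl; <⇒≱; ≮⇒≥; n≤1+n; m≤m+n; m≤n+m; m≤m*n;
         m≤n⇒∃[o]m+o≡n; suc-injective; +-identityʳ; +-suc; +-assoc; +-mono-≤; +-monoˡ-≤; +-monoʳ-≤;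
         +-monoʳ-<; +-cancelˡ-<; *-mono-≤; *-monoˡ-≤; *-monoʳ-≤; module ≤-Reasoning)
open import Data.Nat.Tactic.RingSolver using (solve-∀)
open import Data.Product using (Σ-syntax; ∃-syntax; _×_; _,_; proj₁; proj₂; uncurry)
open import Data.Sum using (_⊎_; inj₁; inj₂)
open import Data.Unit using (⊤; tt)
open import Data.Vec using ([]; _∷_)
open import Function using (id; _∘_)
open import Function.Bundles using (mk⇔; Equivalence)
open import Function.Properties.Equivalence using () renaming (sym to ⇔-sym; trans to ⇔-trans)
open import Relation.Binary.PropositionalEquality using (_≡_; refl; subst; sym; trans; cong; cong₂)
open import Relation.Nullary using (yes; no; ¬_)
open import Relation.Nullary.Decidable using (map′; _×-dec_; _⊎-dec_; ¬?)
open import Relation.Unary using (Decidable)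

private
  variable
    a ρ X Y   : Subset s
    g g′      : Guard s
    u w       : Instance s

-- Spines and the words they match

-- The entry (λᵢ , ρᵢ) of a spine stands for λᵢ U (ρᵢ ∧ …).
Spine : ℕ → Set
Spine s = List (Guard s × Subset s)

private
  variable
    r r′ z : Spine s

-- A run must finish within the word; there are no trailing ∅'s to read. This loses nothing when the
-- last set of the spine is nonempty, see `⊨⇒matches`.
data Matches {s} : Spine s → Instance s → Set where
  done : Matches [] w
  take : ρ ⊆ X → Matches r w → Matches ((g , ρ) ∷ r) (X ∷ w)
  skip : ∀ {λ′} → λ′ ⊆ X → Matches ((conj λ′ , ρ) ∷ r) w → Matches ((conj λ′ , ρ) ∷ r) (X ∷ w)

matches? : (r : Spine s) → Decidable (Matches r)
matches? []                 w       = yes done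
matches? (_ ∷ _)            []      = no λ ()
matches? ((bot , ρ) ∷ r)    (X ∷ w) =
  map′ {A = (ρ ⊆ X) × Matches r w}
       (λ (ρ⊆X , m) → take ρ⊆X m)
       (λ { (take ρ⊆X m) → ρ⊆X , m })
       (ρ ⊆? X ×-dec matches? r w)
matches? ((conj λ′ , ρ) ∷ r) (X ∷ w) =
  map′ {A = (ρ ⊆ X) × Matches r w ⊎ (λ′ ⊆ X) × Matches ((conj λ′ , ρ) ∷ r) w}
       (λ { (inj₁ (ρ⊆X , m)) → take ρ⊆X m ; (inj₂ (λ⊆X , m)) → skip λ⊆X m })
       (λ { (take ρ⊆X m) → inj₁ (ρ⊆X , m) ; (skip λ⊆X m) → inj₂ (λ⊆X , m) })
       ((ρ ⊆? X ×-dec matches? r w) ⊎-dec (λ′ ⊆? X ×-dec matches? ((conj λ′ , ρ) ∷ r) w))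

matches-extend : Matches r u → Matches r (u ++ w)
matches-extend done       = done
matches-extend (take p m) = take p (matches-extend m)
matches-extend (skip p m) = skip p (matches-extend m)

matches-enlarge : ∀ u → X ⊆ Y → Matches r (u ++ X ∷ w) → Matches r (u ++ Y ∷ w)
matches-enlarge []      X⊆Y done       = done
matches-enlarge []      X⊆Y (take p m) = take (X⊆Y ∘ p) m
matches-enlarge []      X⊆Y (skip p m) = skip (X⊆Y ∘ p) m
matches-enlarge (_ ∷ u) X⊆Y done       = done
matches-enlarge (_ ∷ u) X⊆Y (take p m) = take p (matches-enlarge u X⊆Y m)
matches-enlarge (_ ∷ u) X⊆Y (skip p m) = skip p (matches-enlarge u X⊆Y m)

-- A block of at least |r| equal letters is either skipped once, and then it can be skipped
-- once more, or exhausts r.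
matches-pump : ∀ u {n} → length r ≤ n →
               Matches r (u ++ replicate n X ++ w) → Matches r (u ++ X ∷ replicate n X ++ w)
matches-pump {r = []} _ _ _ = done
matches-pump {r = _ ∷ _} []      (s≤s |r|≤n) (take p m) = take p (matches-pump [] |r|≤n m)
matches-pump {r = _ ∷ _} []      (s≤s _)     (skip p m) = skip p (skip p m)
matches-pump {r = _ ∷ _} (_ ∷ u) |r|≤n       (skip p m) = skip p (matches-pump u |r|≤n m)
matches-pump {r = _ ∷ _} (_ ∷ u) |r|≤n       (take p m) =
  take p (matches-pump u (≤-trans (n≤1+n _) |r|≤n) m)

-- Minimal words and the critical word for absorption

-- Minimal words of a spine with at most N letters in each skipped block, and at most k in
-- the first one.
data Candidate {s} (N : ℕ) : ℕ → Spine s → Instance s → Set where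
  done : ∀ {k} → Candidate N k [] []
  take : ∀ {k} → Candidate N N r w → Candidate N k ((g , ρ) ∷ r) (ρ ∷ w)
  skip : ∀ {k λ′} → Candidate N k ((conj λ′ , ρ) ∷ r) w →
         Candidate N (suc k) ((conj λ′ , ρ) ∷ r) (λ′ ∷ w)

candidate⇒matches : ∀ {N k} → Candidate N k r w → Matches r w
candidate⇒matches done     = done
candidate⇒matches (take c) = take id (candidate⇒matches c)
candidate⇒matches (skip c) = skip id (candidate⇒matches c)

-- One more λ′ fits the budget unless the first block already has all its k letters; that case is
-- left to `matches-pump`.
candidate-skip : ∀ {N k λ′} → Candidate N k ((conj λ′ , ρ) ∷ r) w →
                 Candidate N k ((conj λ′ , ρ) ∷ r) (λ′ ∷ w) ⊎ ∃[ v ] w ≡ replicate k λ′ ++ v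
candidate-skip {k = zero}  (take c) = inj₂ (_ , refl)
candidate-skip {k = suc k} (take c) = inj₁ (skip (take c))
candidate-skip (skip c) with candidate-skip c
... | inj₁ c′         = inj₁ (skip c′)
... | inj₂ (v , refl) = inj₂ (v , refl)

-- Induction on the run of r on w: each letter is shrunk to the set that the run compares it with,
-- and `matches-enlarge` restores it. The prefix u collects the letters already shrunk. Skipped
-- blocks of more than N letters are shortened by `matches-pump`, whence |r₀| ≤ N.
candidates-suffice : ∀ {N} (r₀ : Spine s) → length r₀ ≤ N → ∀ u →
                     (∀ {c} → Candidate N N r c → Matches r₀ (u ++ c)) →
                     Matches r w → Matches r₀ (u ++ w)
candidates-suffice r₀ |r₀|≤N u h done =
  matches-extend (subst (Matches r₀) (++-identityʳ u) (h done))
candidates-suffice r₀ |r₀|≤N u h (take {ρ = ρ} ρ⊆X m) =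
  matches-enlarge u ρ⊆X (subst (Matches r₀) (∷ʳ-++ u ρ _)
    (candidates-suffice r₀ |r₀|≤N (u ∷ʳ ρ)
      (λ c → subst (Matches r₀) (sym (∷ʳ-++ u ρ _)) (h (take c))) m))
candidates-suffice {r = r} {N = N} r₀ |r₀|≤N u h (skip {λ′ = λ′} λ⊆X m) =
  matches-enlarge u λ⊆X (subst (Matches r₀) (∷ʳ-++ u λ′ _)
    (candidates-suffice r₀ |r₀|≤N (u ∷ʳ λ′)
      (λ c → subst (Matches r₀) (sym (∷ʳ-++ u λ′ _)) (h′ c)) m))
  where
  h′ : ∀ {c} → Candidate N N r c → Matches r₀ (u ++ λ′ ∷ c)
  h′ c with candidate-skip c
  ... | inj₁ c′         = h c′
  ... | inj₂ (_ , refl) = matches-pump u |r₀|≤N (h c)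

-- The selected candidate violates P if any candidate does.
Selection : (Instance s → Set) → ℕ → ℕ → Spine s → Set
Selection {s} P N k r =
  Σ[ w ∈ Instance s ] Candidate N k r w × (P w → ∀ {c} → Candidate N k r c → P c)

select-either : ∀ {P : Instance s → Set} (P? : Decidable P) {N k ρ λ′ r} →
                Selection (P ∘ (ρ ∷_)) N N r →
                Selection (P ∘ (λ′ ∷_)) N k ((conj λ′ , ρ) ∷ r) →
                Selection P N (suc k) ((conj λ′ , ρ) ∷ r)
select-either P? {ρ = ρ} {λ′} (w , c , all) (w′ , c′ , all′) with P? (ρ ∷ w)
... | no ¬p = ρ ∷ w , take c , λ p → ⊥-elim (¬p p)
... | yes p = λ′ ∷ w′ , skip c′ , λ { _ (take c) → all p c ; p′ (skip c) → all′ p′ c }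

-- There can be exponentially many candidates, but this one stands for all of them and is the only
-- one used in an example.
select : ∀ {P : Instance s → Set} → Decidable P → ∀ N k r → Selection P N k r
select P? N k []                           = [] , done , λ { p done → p }
select P? N k ((bot , ρ) ∷ r)              =
  let w , c , all = select (P? ∘ (ρ ∷_)) N N r in ρ ∷ w , take c , λ { p (take c) → all p c }
select P? N zero ((conj λ′ , ρ) ∷ r)       =
  let w , c , all = select (P? ∘ (ρ ∷_)) N N r in ρ ∷ w , take c , λ { p (take c) → all p c }
select P? N (suc k) r@((conj λ′ , ρ) ∷ r₁) =
  select-either P? (select (P? ∘ (ρ ∷_)) N N r₁) (select (P? ∘ (λ′ ∷_)) N k r)

Absorbs : Subset s → Spine s → Set
Absorbs a r = ∀ {X w} → a ⊆ X → Matches r w → Matches r (X ∷ w)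

-- The one word on which absorption of a is tested. Blocks of up to |r| letters are what
-- `matches-pump` asks for, so its length is quadratic.
critical : Subset s → Spine s → Instance s
critical a r = proj₁ (select (λ w → matches? r (a ∷ w)) (length r) (length r) r)

critical-candidate : ∀ (a : Subset s) r → Candidate (length r) (length r) r (critical a r)
critical-candidate a r = proj₁ (proj₂ (select (λ w → matches? r (a ∷ w)) (length r) (length r) r))

critical-absorbs : ∀ (a : Subset s) r → Matches r (a ∷ critical a r) → Absorbs a r
critical-absorbs a r m a⊆X m′ =
  matches-enlarge [] a⊆X (candidates-suffice r ≤-refl (a ∷ []) (all m) m′)
  where
  all = proj₂ (proj₂ (select (λ w → matches? r (a ∷ w)) (length r) (length r) r))

-- Insertion words and the loops of t′

subsets : ∀ s → List (Subset s)
subsets zero    = [] ∷ []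
subsets (suc s) = map (true ∷_) (subsets s) ++ map (false ∷_) (subsets s)

∈-subsets : (X : Subset s) → X ∈ˡ subsets s
∈-subsets []                    = here refl
∈-subsets (true ∷ X)            = ∈-++⁺ˡ (∈-map⁺ (true ∷_) (∈-subsets X))
∈-subsets {suc s} (false ∷ X) = ∈-++⁺ʳ (map (true ∷_) (subsets s)) (∈-map⁺ (false ∷_) (∈-subsets X))

heads : Spine s → Instance s
heads = map proj₂

guarded : Spine s → Instance s
guarded []                  = []
guarded ((bot , ρ) ∷ r)     = ρ ∷ guarded r
guarded ((conj λ′ , ρ) ∷ r) = λ′ ∷ ρ ∷ guarded r

-- The letter put before ρᵢ ranges over all sets, so it also takes the value of the unknown guard
-- λ′ᵢ. It is followed by ρᵢ ... ρₙ, or by ρᵢ and the critical word that tests whether the rest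
-- absorbs ρᵢ.
insertions : Spine s → List (Instance s)
insertions []                = []
insertions {s} ((g , ρ) ∷ r) =
  map (_∷ ρ ∷ heads r) (subsets s) ++
  map (_∷ ρ ∷ critical ρ r) (subsets s) ++
  map (ρ ∷_) (insertions r)

Peerless : Spine s → Set
Peerless = All (uncurry PeerlessGuard)

SameSets : Spine s → Spine s → Set
SameSets = Pointwise λ x y → proj₂ x ≡ proj₂ y

infix 4 _⊑_ _⊑_on_

_⊑_ : Spine s → Spine s → Set
t ⊑ t′ = ∀ {w} → Matches t w → Matches t′ w

_⊑_on_ : Spine s → Spine s → List (Instance s) → Set
t ⊑ t′ on ws = ∀ {w} → w ∈ˡ ws → Matches t w → Matches t′ w

matches-heads : SameSets r r′ → Matches r′ (heads r)
matches-heads []            = done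
matches-heads (refl ∷ same) = take id (matches-heads same)

module _ {g : Guard s} {ρ r g′ r′}
         (agree : (g′ , ρ) ∷ r′ ⊑ (g , ρ) ∷ r on insertions ((g , ρ) ∷ r)) where

  -- A peerless entry can only advance at its own set, so prefixing ρ passes the test on to the
  -- suffix r.
  insertions-tail : PeerlessGuard g ρ → r′ ⊑ r on insertions r
  insertions-tail peer w∈ m
    with agree (∈-++⁺ʳ (map (_∷ ρ ∷ heads r) (subsets s))
                 (∈-++⁺ʳ (map (_∷ ρ ∷ critical ρ r) (subsets s)) (∈-map⁺ (ρ ∷_) w∈)))
               (take id m)
  ... | take _ m′ = m′
  ... | skip λ⊆ρ _ = ⊥-elim (proj₁ peer λ⊆ρ)

  insertions-heads : ∀ {x} → g′ ≡ conj x → SameSets r r′ → Matches ((g , ρ) ∷ r) (x ∷ ρ ∷ heads r)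
  insertions-heads {x} refl same =
    agree (∈-++⁺ˡ (∈-map⁺ (_∷ ρ ∷ heads r) (∈-subsets x))) (skip id (take id (matches-heads same)))

  insertions-critical : ∀ {x} → g′ ≡ conj x → Matches ((g′ , ρ) ∷ r′) (ρ ∷ critical ρ r) →
                        Matches ((g , ρ) ∷ r) (x ∷ ρ ∷ critical ρ r)
  insertions-critical {x} refl m =
    agree (∈-++⁺ʳ (map (_∷ ρ ∷ heads r) (subsets s))
            (∈-++⁺ˡ (∈-map⁺ (_∷ ρ ∷ critical ρ r) (∈-subsets x))))
          (skip id m)

-- How t can follow a loop g′ of t′: there is none, t loops as well, or t advances at the first
-- looped letter and r absorbs the letters up to and including the one that t′ takes as ρ.
data Covered {s} (ρ : Subset s) (r : Spine s) : Guard s → Guard s → Set where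
  bot    : Covered ρ r g bot
  weaker : ∀ {λ′ x} → λ′ ⊆ x → Covered ρ r (conj λ′) (conj x)
  absorb : ∀ {x} → ρ ⊆ x → Absorbs ρ r → Covered ρ r g (conj x)

covered⇒⊑ : Covered ρ r g g′ → r′ ⊑ r → (g′ , ρ) ∷ r′ ⊑ (g , ρ) ∷ r
covered⇒⊑ c            r′⊑r (take p m) = take p (r′⊑r m)
covered⇒⊑ (weaker λ⊆x) r′⊑r (skip p m) = skip (p ∘ λ⊆x) (covered⇒⊑ (weaker λ⊆x) r′⊑r m)
covered⇒⊑ {ρ = ρ} {r} {r′ = r′} (absorb {x = x} ρ⊆x abs) r′⊑r (skip p m) = take (p ∘ ρ⊆x) (absorbed m)
  where
  absorbed : (conj x , ρ) ∷ r′ ⊑ r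
  absorbed (take p m) = abs p (r′⊑r m)
  absorbed (skip p m) = abs (p ∘ ρ⊆x) (absorbed m)

-- Since t′ may skip its guard x first, t matches `x ∷ ρ ∷ critical ρ r`. If t advances at x, then r
-- reads the critical test word; otherwise the guard of t is contained in x.
covered : ∀ {g : Guard s} {ρ r g′ r′} → (g′ , ρ) ∷ r′ ⊑ (g , ρ) ∷ r on insertions ((g , ρ) ∷ r) →
          Matches ((g′ , ρ) ∷ r′) (ρ ∷ critical ρ r) → Covered ρ r g g′
covered {g′ = bot}    agree m = bot
covered {ρ = ρ} {r} {g′ = conj x} agree m with insertions-critical agree refl m
... | take ρ⊆x m′ = absorb ρ⊆x (critical-absorbs ρ r m′)
... | skip λ⊆x _  = weaker λ⊆x

-- Following the run of t′ on the guarded word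

Above : Subset s → Guard s → Set
Above a bot      = ⊤
Above a (conj x) = a ⊆ x

-- The states of a late run within a block whose sets all equal a; r′ comes after the block.
data Lag {s} (a : Subset s) (r′ : Spine s) : Spine s → Set where
  last : Above a g → Lag a r′ ((g , a) ∷ r′)
  more : Above a g → Lag a r′ z → Lag a r′ ((g , a) ∷ z)

-- With guard ⊥, t can only take the inserted letter x as a.
insertions-above : ∀ (g′ : Guard s) {r′} → (g′ , a) ∷ r′ ⊑ (bot , a) ∷ r on insertions ((bot , a) ∷ r) →
                   SameSets r r′ → Above a g′
insertions-above bot      agree same = tt
insertions-above (conj x) agree same with insertions-heads agree refl same
... | take a⊆x _ = a⊆x

above⇒covered : ∀ (g : Guard s) → Above a g → Absorbs a r → Covered a r bot g
above⇒covered bot      _   _   = bot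
above⇒covered (conj _) a⊆x abs = absorb a⊆x abs

-- All sets in the block are a and all guards lie above a, so a late run reads a letter containing a
-- whether it takes or skips.
lag-step : Lag a r′ z → Matches z (X ∷ w) →
           a ⊆ X × ((∃[ z′ ] Lag a r′ z′ × Matches z′ w) ⊎ Matches r′ w)
lag-step (last _)   (take a⊆X m) = a⊆X , inj₂ m
lag-step l@(last a⊆x) (skip x⊆X m) = x⊆X ∘ a⊆x , inj₁ (_ , l , m)
lag-step (more _ l) (take a⊆X m) = a⊆X , inj₁ (_ , l , m)
lag-step l@(more a⊆x _) (skip x⊆X m) = x⊆X ∘ a⊆x , inj₁ (_ , l , m)

lag-extend : Above a g → Lag a ((g , a) ∷ r′) z → Lag a r′ z
lag-extend above (last p)   = more p (last above)
lag-extend above (more p l) = more p (lag-extend above l)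

-- Here t′ is about to read ρ in step with t; in `resumed` it is in step before the guard, in
-- `lagging` it is late. The first conclusion leaves out skips at g, because they depend on how the
-- letter before ρ was read.
synced : ∀ {g : Guard s} {ρ} r {g′ r′} → PeerlessGuard g ρ → Peerless r → SameSets r r′ →
         (g′ , ρ) ∷ r′ ⊑ (g , ρ) ∷ r on insertions ((g , ρ) ∷ r) →
         Matches ((g′ , ρ) ∷ r′) (ρ ∷ guarded r) →
         (∀ {X w} → ρ ⊆ X → Matches r w → Matches ((g′ , ρ) ∷ r′) (X ∷ w)) ×
         (g′ , ρ) ∷ r′ ⊑ (g , ρ) ∷ r

resumed : ∀ (r : Spine s) {r′} → Peerless r → SameSets r r′ → r′ ⊑ r on insertions r →
          Matches r′ (guarded r) → r ⊑ r′ × r′ ⊑ r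

-- Φ w stands for acceptance of w after the block of a's, by the state in which the run fell
-- behind; r is what follows the block in the peerless query.
lagging : ∀ {a : Subset s} r {r′ z} (Φ : Instance s → Set) →
          (∀ {w} → Matches r′ w → Φ w) → (∀ {X w} → a ⊆ X → Φ w → Φ (X ∷ w)) →
          Lag a r′ z → Peerless r → SameSets r r′ → r′ ⊑ r on insertions r →
          Matches r (a ∷ heads r) → Matches z (guarded r) →
          (∀ {w} → Matches r w → Φ w) × r′ ⊑ r × Absorbs a r

synced {g = g} {ρ} r {g′} {r′} peer peers same agree (take _ m)
  with resumed r peers same (insertions-tail agree peer) m
-- The forward inclusion is needed first: it puts `ρ ∷ critical ρ r` into L(t′), as `covered`
-- requires.
... | r⊑r′ , r′⊑r = forward , covered⇒⊑ (covered agree (forward id crit)) r′⊑r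
  where
  crit = candidate⇒matches (critical-candidate ρ r)
  forward : ∀ {X w} → ρ ⊆ X → Matches r w → Matches ((g′ , ρ) ∷ r′) (X ∷ w)
  forward ρ⊆X m = take ρ⊆X (r⊑r′ m)
-- The run falls behind. Since t also matches x followed by ρ and the later sets, and skipping x
-- would make its guard a subset of ρ, it follows that ρ ⊆ x.
synced {g = g} {ρ} r {conj x} {r′} peer peers same agree (skip x⊆ρ m)
  with insertions-heads agree refl same
... | skip λ⊆x _  = ⊥-elim (proj₁ peer (x⊆ρ ∘ λ⊆x))
... | take ρ⊆x mh
  -- An extra letter containing ρ is skipped at x ⊆ ρ, the loop at the beginning of the block.
  with lagging r (λ w → ∀ {X} → ρ ⊆ X → Matches ((conj x , ρ) ∷ r′) (X ∷ w))
         (λ m p → take p m) (λ p φ q → skip (q ∘ x⊆ρ) (φ p)) (last {g = conj x} ρ⊆x)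
         peers same (insertions-tail agree peer) mh m
...   | forward , r′⊑r , abs = (λ p m → forward m p) , covered⇒⊑ (absorb ρ⊆x abs) r′⊑r

resumed [] [] [] agree m = id , id
resumed ((bot , ρ) ∷ r) {(g′ , _) ∷ r′} (peer ∷ peers) (refl ∷ same) agree m
  with synced r {g′} peer peers same agree m
... | forward , r′⊑r = (λ { (take p m) → forward p m }) , r′⊑r
-- The run never gets ahead: reading λ′ as ρ would make them comparable.
resumed ((conj λ′ , ρ) ∷ r) (peer ∷ peers) (refl ∷ same) agree (take ρ⊆λ _) = ⊥-elim (proj₂ peer ρ⊆λ)
resumed ((conj λ′ , ρ) ∷ r) {(conj x , _) ∷ r′} (peer ∷ peers) (refl ∷ same) agree (skip x⊆λ m)
  with synced r {conj x} peer peers same agree m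
... | forward , r′⊑r = include , r′⊑r
  where
  include : (conj λ′ , ρ) ∷ r ⊑ (conj x , ρ) ∷ r′
  include (take p m) = forward p m
  include (skip p m) = skip (p ∘ x⊆λ) (include m)

-- No letter is left for the entries of z: a late run has to catch up before the word ends.
lagging [] Φ accept grow (last _)   peers same agree mh ()
lagging [] Φ accept grow (more _ _) peers same agree mh ()
-- The block ends at this guard, whose letter gives the late run the time to catch up. The run
-- yields a ⊆ λ′, and `mh` yields λ′ ⊆ a by peerlessness.
lagging ((conj λ′ , ρ) ∷ r) {(g′ , _) ∷ r′} Φ accept grow lag (peer ∷ peers) (refl ∷ same) agree mh m
  with lag-step lag m
... | a⊆λ , rest with mh
...   | take ρ⊆a _ = ⊥-elim (proj₂ peer (a⊆λ ∘ ρ⊆a))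
...   | skip λ⊆a _ with rest
-- A run still late would read ρ inside the block, whence λ′ ⊆ a ⊆ ρ.
...     | inj₁ (_ , lag′ , m′) = ⊥-elim (proj₁ peer (proj₁ (lag-step lag′ m′) ∘ λ⊆a))
...     | inj₂ m′ with synced r {g′} peer peers same agree m′
...       | forward , r′⊑r = include , r′⊑r , λ p → skip (p ∘ λ⊆a)
  where
  include : ∀ {w} → Matches ((conj λ′ , ρ) ∷ r) w → Φ w
  include (take p m) = accept (forward p m)
  -- Where t loops at the end of the block, t′ loops at its beginning.
  include (skip p m) = grow (p ∘ a⊆λ) (include m)
lagging {s} {a} ((bot , ρ) ∷ r) {(g′ , _) ∷ r′} Φ accept grow lag (peer ∷ peers) (refl ∷ same) agree
        (take ρ⊆a mh) m
  with lag-step lag m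
-- With guard ⊥, t reads a as ρ, so ρ = a and the block goes on.
... | a⊆ρ , rest with ⊆-antisym a⊆ρ ρ⊆a
...   | refl with lagging r (λ w → ∀ {X} → a ⊆ X → Φ (X ∷ w))
                   (λ m p → accept (take p m)) (λ p φ q → grow q (φ p))
                   (proj₁ (proj₂ (next rest))) peers same (insertions-tail agree tt) mh
                   (proj₂ (proj₂ (next rest)))
  where
  next : (∃[ z′ ] Lag a ((g′ , a) ∷ r′) z′ × Matches z′ (guarded r)) ⊎
         Matches ((g′ , a) ∷ r′) (guarded r) →
         ∃[ z′ ] Lag a r′ z′ × Matches z′ (guarded r)
  next (inj₁ (z′ , lag′ , m′)) = z′ , lag-extend (insertions-above g′ agree same) lag′ , m′
  -- Past the old block, the run is still one set behind t.
  next (inj₂ m′)               = _ , last (insertions-above g′ agree same) , m′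
...     | forward , r′⊑r , abs =
  (λ { (take p m) → forward m p }) ,
  covered⇒⊑ (above⇒covered g′ (insertions-above g′ agree same) abs) r′⊑r ,
  (λ { p (take q m) → take p (abs q m) })

-- Recovering the length and the sets

tops : Spine s → List (Instance s)
tops []            = []
tops {s} (_ ∷ r) = map (_∷ replicate (length r) ⊤ˢ) (subsets s) ++ map (⊤ˢ ∷_) (tops r)

∈-tops⁻ : ∀ (r : Spine s) {w} → w ∈ˡ tops r → length w ≡ length r
∈-tops⁻ {s} (_ ∷ r) w∈ with ∈-++⁻ (map (_∷ replicate (length r) ⊤ˢ) (subsets s)) w∈
... | inj₁ w∈₁ with _ , _ , refl ← ∈-map⁻ _ w∈₁ = cong suc (length-replicate (length r))
... | inj₂ w∈₂ with _ , v∈ , refl ← ∈-map⁻ _ w∈₂ = cong suc (∈-tops⁻ r v∈)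

matches-length : Matches r w → length r ≤ length w
matches-length done       = z≤n
matches-length (take _ m) = s≤s (matches-length m)
matches-length (skip _ m) = ≤-trans (matches-length m) (n≤1+n _)

-- After a skip fewer letters than entries remain. Hence on the words of `tops` only the comparison
-- of one set with X counts.
matches-tight : length w ≡ length r → Matches ((g , ρ) ∷ r) (X ∷ w) → ρ ⊆ X × Matches r w
matches-tight eq (take ρ⊆X m) = ρ⊆X , m
matches-tight eq (skip _ m)   = ⊥-elim (<-irrefl (sym eq) (matches-length m))

matches-full : ∀ (r : Spine s) → Matches r (replicate (length r) ⊤ˢ)
matches-full []      = done
matches-full (_ ∷ r) = take ⊆⊤ (matches-full r)

LastNonempty : Spine s → Set
LastNonempty []            = ⊤
LastNonempty ((_ , ρ) ∷ []) = Nonempty ρ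
LastNonempty (_ ∷ x ∷ r)   = LastNonempty (x ∷ r)

tops-tail : ∀ {x : Guard s × Subset s} {r r′ t′} → (∀ {w} → Matches r′ w → Matches t′ (⊤ˢ ∷ w)) →
            t′ ⊑ x ∷ r on tops (x ∷ r) → r′ ⊑ r on tops r
tops-tail {s} {r = r} up agree w∈ m =
  proj₂ (matches-tight (∈-tops⁻ r w∈)
    (agree (∈-++⁺ʳ (map (_∷ replicate (length r) ⊤ˢ) (subsets s)) (∈-map⁺ (⊤ˢ ∷_) w∈)) (up m)))

-- A shorter spine has finished before the last letter, so it accepts ∅ there, which the nonempty
-- last set of r does not.
not-shorter : ∀ (r r′ : Spine s) → LastNonempty r → r′ ⊑ r on tops r → ¬ length r′ < length r
not-shorter ((_ , ρ) ∷ []) [] (A , A∈ρ) agree _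
  with agree (∈-++⁺ˡ (∈-map⁺ (_∷ []) (∈-subsets ∅))) done
... | take ρ⊆∅ _ = ∉⊥ (ρ⊆∅ A∈ρ)
not-shorter (_ ∷ []) (_ ∷ _) _ _ (s≤s ())
not-shorter (_ ∷ r@(_ ∷ _)) []       ends agree _         =
  not-shorter r [] ends (tops-tail {r′ = []} (λ _ → done) agree) (s≤s z≤n)
not-shorter (_ ∷ r@(_ ∷ _)) (_ ∷ r′) ends agree (s≤s lt) =
  not-shorter r r′ ends (tops-tail (take ⊆⊤) agree) lt

-- The word of heads gives ρ′ᵢ ⊆ ρᵢ, and the word of `tops` with X = ρ′ᵢ gives the converse.
same-sets : ∀ (r r′ : Spine s) → length r′ ≡ length r → Matches r′ (heads r) →
            r′ ⊑ r on tops r → SameSets r r′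
same-sets []            []              _  _ _     = []
same-sets ((g , ρ) ∷ r) ((g′ , ρ′) ∷ r′) eq m agree
  with matches-tight (trans (length-map proj₂ r) (sym (suc-injective eq))) m
... | ρ′⊆ρ , m′ = ⊆-antisym ρ⊆ρ′ ρ′⊆ρ ∷ same-sets r r′ (suc-injective eq) m′ (tops-tail (take ⊆⊤) agree)
  where
  ρ⊆ρ′ : ρ ⊆ ρ′
  ρ⊆ρ′ = proj₁ (matches-tight (length-replicate (length r))
    (agree (∈-++⁺ˡ (∈-map⁺ (_∷ replicate (length r) ⊤ˢ) (∈-subsets ρ′)))
           (take id (subst (λ n → Matches r′ (replicate n ⊤ˢ)) (suc-injective eq) (matches-full r′)))))

negatives : Spine s → List (Instance s)
negatives t = tops t ++ insertions t

characterised : ∀ {g : Guard s} {ρ r g′ ρ′ r′} → let t = (g , ρ) ∷ r ; t′ = (g′ , ρ′) ∷ r′ in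
                LastNonempty r → Peerless t → Matches t′ (heads t) →
                Matches t′ (guarded ((bot , ρ) ∷ r)) →
                t′ ⊑ t on negatives t → (bot , ρ) ∷ r ⊑ t′ × t′ ⊑ t
characterised {g = g} {ρ} {r} {g′} {ρ′} {r′} ends (peer ∷ peers) mh mg agree
  with same-sets ((g , ρ) ∷ r) ((g′ , ρ′) ∷ r′) (cong suc |r′|≡|r|) mh (λ w∈ → agree (∈-++⁺ˡ w∈))
  where
  |r′|≡|r| : length r′ ≡ length r
  |r′|≡|r| = ≤-antisym
    (≤-trans (s≤s⁻¹ (matches-length mh)) (≤-reflexive (length-map proj₂ r)))
    (≮⇒≥ (not-shorter r r′ ends
      (tops-tail {t′ = (g′ , ρ′) ∷ r′} (take ⊆⊤) (λ w∈ → agree (∈-++⁺ˡ w∈)))))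
... | refl ∷ same with synced r peer peers same (λ w∈ → agree (∈-++⁺ʳ (tops ((g , ρ) ∷ r)) w∈)) mg
...   | forward , t′⊑t = (λ { (take p m) → forward p m }) , t′⊑t

-- Semantics of path queries

⋀-elim : ∀ {D : Instance s} {ℓ} As → D , ℓ ⊨ ⋀ As → ∀ {A} → A ∈ˡ As → A ∈ D at ℓ
⋀-elim (_ ∷ [])     A∈D       (here refl) = A∈D
⋀-elim (_ ∷ _ ∷ _)  (A∈D , _) (here refl) = A∈D
⋀-elim (_ ∷ B ∷ As) (_ , h)   (there A∈)  = ⋀-elim (B ∷ As) h A∈

⋀-intro : ∀ {D : Instance s} {ℓ} As → (∀ {A} → A ∈ˡ As → A ∈ D at ℓ) → D , ℓ ⊨ ⋀ As
⋀-intro []           h = tt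
⋀-intro (_ ∷ [])     h = h (here refl)
⋀-intro (_ ∷ B ∷ As) h = h (here refl) , ⋀-intro (B ∷ As) (h ∘ there)

conjunction-elim : ∀ {D : Instance s} {ℓ} ρ → D , ℓ ⊨ conjunction ρ → ρ ⊆ D at ℓ
conjunction-elim ρ h {A} A∈ρ =
  ⋀-elim (filter (_∈? ρ) (allFin _)) h (∈-filter⁺ (_∈? ρ) (∈-allFin A) A∈ρ)

conjunction-intro : ∀ {D : Instance s} {ℓ} ρ → ρ ⊆ D at ℓ → D , ℓ ⊨ conjunction ρ
conjunction-intro ρ ρ⊆D =
  ⋀-intro (filter (_∈? ρ) (allFin _)) λ A∈ → ρ⊆D (proj₂ (∈-filter⁻ (_∈? ρ) {xs = allFin _} A∈))

-- Truth at ℓ depends only on the sequence from ℓ on, so positions can be traded for suffixes.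
shift : ∀ (q : Query s) {D D′ : Instance s} {ℓ ℓ′} → (∀ k → D at (ℓ + k) ≡ D′ at (ℓ′ + k)) →
        D , ℓ ⊨ q → D′ , ℓ′ ⊨ q
shift (atom A) {D} {D′} {ℓ} {ℓ′} eq A∈ =
  subst (A ∈_)
    (trans (cong (D at_) (sym (+-identityʳ ℓ))) (trans (eq 0) (cong (D′ at_) (+-identityʳ ℓ′)))) A∈
shift `⊤        eq h         = tt
shift (q₁ ∧ q₂) eq (h₁ , h₂) = shift q₁ eq h₁ , shift q₂ eq h₂
shift (q₁ U q₂) {D} {D′} {ℓ} {ℓ′} eq (m , ℓ<m , h₂ , h₁) with o , refl ← m≤n⇒∃[o]m+o≡n ℓ<m =
  suc ℓ′ + o , m≤m+n (suc ℓ′) o , shift q₂ (eq′ o) h₂ , between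
  where
  eq′ : ∀ o k → D at (suc ℓ + o + k) ≡ D′ at (suc ℓ′ + o + k)
  eq′ o k = trans (cong (D at_) (move ℓ)) (trans (eq (suc o + k)) (cong (D′ at_) (sym (move ℓ′))))
    where
    move : ∀ ℓ → suc ℓ + o + k ≡ ℓ + (suc o + k)
    move ℓ = trans (+-assoc (suc ℓ) o k) (sym (+-suc ℓ (o + k)))
  between : ∀ k → ℓ′ < k → k < suc ℓ′ + o → D′ , k ⊨ q₁
  between k ℓ′<k k<m with i , refl ← m≤n⇒∃[o]m+o≡n ℓ′<k =
    shift q₁ (eq′ i) (h₁ (suc ℓ + i) (m≤m+n (suc ℓ) i)
                        (+-monoʳ-< (suc ℓ) (+-cancelˡ-< (suc ℓ′) i o k<m)))

mutual
  -- With g = ⊥ the first letter must be taken, so `spine bot p` reads from the evaluation point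
  -- itself.
  spine : Guard s → Path s → Spine s
  spine g p = (g , head p) ∷ rest p

  rest : Path s → Spine s
  rest (end _)      = []
  rest (step _ g p) = spine g p

Anchored : Path s → Set
Anchored (end ρ)      = Nonempty ρ
Anchored (step _ _ p) = Anchored p

Proper : Path s → Set
Proper (end _)      = ⊤
Proper (step _ _ p) = Anchored p

anchored⇒proper : ∀ (p : Path s) → Anchored p → Proper p
anchored⇒proper (end _)      _ = tt
anchored⇒proper (step _ _ _) a = a

anchored⇒last : ∀ (g : Guard s) p → Anchored p → LastNonempty (spine g p)
anchored⇒last g (end _)       a = a
anchored⇒last g (step _ g′ p) a = anchored⇒last g′ p a

proper⇒last : ∀ (p : Path s) → Proper p → LastNonempty (rest p)
proper⇒last (end _)      _ = tt
proper⇒last (step _ g p) a = anchored⇒last g p a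

anchored⇒[]⊭ : ∀ (p : Path s) {ℓ} → Anchored p → ¬ [] , ℓ ⊨ query p
anchored⇒[]⊭ (end ρ)      (A , A∈ρ) h                    = ∉⊥ (conjunction-elim ρ h A∈ρ)
anchored⇒[]⊭ (step _ _ p) a         (_ , m , _ , h , _) = anchored⇒[]⊭ p a h

mutual
  -- Witnesses of U lie within the word: past its end there are only ∅'s, excluded by
  -- `anchored⇒[]⊭`.
  ⊨⇒matches : ∀ (p : Path s) {X w} → Proper p → X ∷ w , 0 ⊨ query p → Matches (spine bot p) (X ∷ w)
  ⊨⇒matches (end ρ)      _ h                          = take (conjunction-elim ρ h) done
  ⊨⇒matches (step ρ g p) {w = w} a (h , m , 0<m , h₂ , h₁) =
    take (conjunction-elim ρ h) (until⇒matches g p w m a 0<m h₂ h₁)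

  until⇒matches : ∀ (g : Guard s) p {X} w m → Anchored p → 0 < m → X ∷ w , m ⊨ query p →
                  (∀ k → 0 < k → k < m → X ∷ w , k ⊨ guard g) → Matches (spine g p) w
  until⇒matches g p []      (suc m)       a _ h₂ h₁ =
    ⊥-elim (anchored⇒[]⊭ p a (shift (query p) {ℓ′ = m} (λ _ → refl) h₂))
  until⇒matches g p (Y ∷ w) 1             a _ h₂ h₁
    with ⊨⇒matches p {Y} {w} (anchored⇒proper p a) (shift (query p) (λ _ → refl) h₂)
  ... | take ρ⊆Y m = take ρ⊆Y m
  until⇒matches bot p (Y ∷ w) (suc (suc m)) a _ h₂ h₁ = ⊥-elim (h₁ 1 (s≤s z≤n) (s≤s (s≤s z≤n)))
  until⇒matches g@(conj λ′) p {X} (Y ∷ w) (suc (suc m)) a _ h₂ h₁ =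
    skip (conjunction-elim {D = X ∷ Y ∷ w} {1} λ′ (h₁ 1 (s≤s z≤n) (s≤s (s≤s z≤n))))
         (until⇒matches g p {Y} w (suc m) a (s≤s z≤n) (shift (query p) (λ _ → refl) h₂)
           λ k 0<k k<m → shift (guard g) (λ _ → refl) (h₁ (suc k) (s≤s z≤n) (s≤s k<m)))

mutual
  matches⇒⊨ : ∀ (p : Path s) {X w} → Matches (spine bot p) (X ∷ w) → X ∷ w , 0 ⊨ query p
  matches⇒⊨ (end ρ)      (take p _) = conjunction-intro ρ p
  matches⇒⊨ (step ρ g p) (take q m) = conjunction-intro ρ q , matches⇒until g p m

  matches⇒until : ∀ (g : Guard s) p {X w} → Matches (spine g p) w → X ∷ w , 0 ⊨ guard g U query p
  matches⇒until g p {X} {Y ∷ w} (take q m) =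
    1 , s≤s z≤n , shift (query p) (λ _ → refl) (matches⇒⊨ p {Y} {w} (take q m)) ,
    λ { (suc k) _ (s≤s ()) }
  matches⇒until g@(conj λ′) p {X} {Y ∷ w} (skip q m) with matches⇒until g p {Y} m
  ... | n , 0<n , h₂ , h₁ = suc n , s≤s z≤n , shift (query p) (λ _ → refl) h₂ , between
    where
    between : ∀ k → 0 < k → k < suc n → X ∷ Y ∷ w , k ⊨ guard g
    between 1             _ _         = conjunction-intro λ′ q
    between (suc (suc k)) _ (s≤s k<n) = shift (guard g) (λ _ → refl) (h₁ (suc k) (s≤s z≤n) k<n)

at-drop : ∀ n (D : Instance s) k → drop n D at k ≡ D at (n + k)
at-drop zero    D       k = refl
at-drop (suc n) []      k = refl
at-drop (suc n) (_ ∷ D) k = at-drop n D k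

-- Unlike drop ℓ D, this is nonempty also when ℓ is beyond the end of D.
suffix : Instance s → ℕ → Instance s
suffix D ℓ = D at ℓ ∷ drop (suc ℓ) D

suffix-at : ∀ (D : Instance s) ℓ k → suffix D ℓ at k ≡ D at (ℓ + k)
suffix-at D ℓ zero    = cong (D at_) (sym (+-identityʳ ℓ))
suffix-at D ℓ (suc k) = trans (at-drop (suc ℓ) D k) (cong (D at_) (sym (+-suc ℓ k)))

⊑⇒⊨ : ∀ (p p′ : Path s) → Proper p → spine bot p ⊑ spine bot p′ → ∀ {D ℓ} →
      D , ℓ ⊨ query p → D , ℓ ⊨ query p′
⊑⇒⊨ p p′ proper p⊑p′ {D} {ℓ} h =
  shift (query p′) (suffix-at D ℓ)
    (matches⇒⊨ p′ (p⊑p′ (⊨⇒matches p proper (shift (query p) (λ k → sym (suffix-at D ℓ k)) h))))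

-- Normal forms of paths

-- Trailing conditions λ U ⊤ hold everywhere and are dropped.
attach : Subset s → Guard s → Path s → Path s
attach ρ g (end ρ′) with nonempty? ρ′
... | yes _ = step ρ g (end ρ′)
... | no _  = end ρ
attach ρ g p@(step _ _ _) = step ρ g p

normalise : Path s → Path s
normalise (end ρ)      = end ρ
normalise (step ρ g p) = attach ρ g (normalise p)

attach-head : ∀ (ρ : Subset s) g p → head (attach ρ g p) ≡ ρ
attach-head ρ g (end ρ′) with nonempty? ρ′
... | yes _ = refl
... | no _  = refl
attach-head ρ g (step _ _ _) = refl

normalise-head : ∀ (p : Path s) → head (normalise p) ≡ head p
normalise-head (end _)      = refl
normalise-head (step ρ g p) = attach-head ρ g (normalise p)

attach-proper : ∀ (ρ : Subset s) g p → Proper p → Proper (attach ρ g p)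
attach-proper ρ g (end ρ′) _ with nonempty? ρ′
... | yes ne = ne
... | no _   = tt
attach-proper ρ g (step _ _ _) a = a

normalise-proper : ∀ (p : Path s) → Proper (normalise p)
normalise-proper (end _)      = tt
normalise-proper (step ρ g p) = attach-proper ρ g (normalise p) (normalise-proper p)

attach-peerless : ∀ (ρ : Subset s) g p → Peerless (spine g p) → Peerless (rest (attach ρ g p))
attach-peerless ρ g (end ρ′) peers with nonempty? ρ′
... | yes _ = peers
... | no _  = []
attach-peerless ρ g (step _ _ _) peers = peers

normalise-peerless : ∀ (p : Path s) → PeerlessPath p → Peerless (rest (normalise p))
normalise-peerless (end _)      _              = []
normalise-peerless (step ρ g p) (peer , peers) =
  attach-peerless ρ g (normalise p)
    (subst (PeerlessGuard g) (sym (normalise-head p)) peer ∷ normalise-peerless p peers)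

attach-length : ∀ (ρ : Subset s) g p → length (rest (attach ρ g p)) ≤ suc (length (rest p))
attach-length ρ g (end ρ′) with nonempty? ρ′
... | yes _ = ≤-refl
... | no _  = z≤n
attach-length ρ g (step _ _ _) = ≤-refl

⋀-size : ∀ (As : List (Fin s)) → 1 ≤ ∥ ⋀ As ∥
⋀-size []          = ≤-refl
⋀-size (_ ∷ [])    = ≤-refl
⋀-size (_ ∷ _ ∷ _) = s≤s z≤n

-- Each step contributes at least its conjunction sign, and the final set at least one symbol.
normalise-length : ∀ (p : Path s) → suc (length (rest (normalise p))) ≤ ∥ query p ∥
normalise-length (end ρ)      = ⋀-size (filter (_∈? ρ) (allFin _))
normalise-length (step ρ g p) = s≤s (≤-trans (attach-length ρ g (normalise p))
  (≤-trans (normalise-length p) (≤-trans (m≤n+m _ _) (≤-trans (n≤1+n _) (m≤n+m _ ∥ conjunction ρ ∥)))))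

attach-⊨ : ∀ (ρ : Subset s) g p {D ℓ} → D , ℓ ⊨ query (step ρ g p) → D , ℓ ⊨ query (attach ρ g p)
attach-⊨ ρ g (end ρ′) h with nonempty? ρ′
... | yes _ = h
... | no _  = proj₁ h
attach-⊨ ρ g (step _ _ _) h = h

attach-⊨⁻ : ∀ (ρ : Subset s) g p {D ℓ} → D , ℓ ⊨ query (attach ρ g p) → D , ℓ ⊨ query (step ρ g p)
attach-⊨⁻ ρ g (end ρ′) {D} {ℓ} h with nonempty? ρ′
... | yes _  = h
-- Nothing lies strictly between ℓ and its successor, so g is not tested, even if it is ⊥.
... | no ¬ne = h , suc ℓ , ≤-refl , conjunction-intro {D = D} ρ′ (λ A∈ → ⊥-elim (¬ne (_ , A∈))) ,
               λ k ℓ<k k<1+ℓ → ⊥-elim (<⇒≱ ℓ<k (s≤s⁻¹ k<1+ℓ))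
attach-⊨⁻ ρ g (step _ _ _) h = h

normalise-⊨ : ∀ (p : Path s) {D ℓ} → D , ℓ ⊨ query p → D , ℓ ⊨ query (normalise p)
normalise-⊨ (end _)      h                          = h
normalise-⊨ (step ρ g p) {D} (h , m , ℓ<m , h₂ , h₁) =
  attach-⊨ ρ g (normalise p) {D} (h , m , ℓ<m , normalise-⊨ p h₂ , h₁)

normalise-⊨⁻ : ∀ (p : Path s) {D ℓ} → D , ℓ ⊨ query (normalise p) → D , ℓ ⊨ query p
normalise-⊨⁻ (end _)      h = h
normalise-⊨⁻ (step ρ g p) {D} h with attach-⊨⁻ ρ g (normalise p) {D} h
... | h , m , ℓ<m , h₂ , h₁ = h , m , ℓ<m , normalise-⊨⁻ p h₂ , h₁

-- The example set and its size

candidate-length : ∀ {N k} → Candidate N k r w → length w ≤ k + length r * suc N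
candidate-length done = z≤n
candidate-length {N = N} {k} (take c) = ≤-trans (s≤s (candidate-length c)) (m≤n+m _ k)
candidate-length (skip c) = s≤s (candidate-length c)

-- The lower bound serves `⊨⇒matches′`: the empty list satisfies ⊤, but no nonempty spine matches
-- it.
Bounded : ℕ → Instance s → Set
Bounded B w = 0 < length w × length w ≤ B

insertions-bounded : ∀ (r : Spine s) {w} → w ∈ˡ insertions r → Bounded (1 + length r * length r) w
insertions-bounded {s} ((g , ρ) ∷ r) w∈ with ∈-++⁻ (map (_∷ ρ ∷ heads r) (subsets s)) w∈
... | inj₁ w∈₁ with _ , _ , refl ← ∈-map⁻ _ w∈₁ =
      s≤s z≤n , s≤s (s≤s (≤-trans (≤-reflexive (length-map proj₂ r)) (m≤m+n _ _)))
... | inj₂ w∈₂ with ∈-++⁻ (map (_∷ ρ ∷ critical ρ r) (subsets s)) w∈₂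
...   | inj₁ w∈₃ with _ , _ , refl ← ∈-map⁻ _ w∈₃ =
        s≤s z≤n , s≤s (s≤s (candidate-length (critical-candidate ρ r)))
...   | inj₂ w∈₄ with _ , v∈ , refl ← ∈-map⁻ _ w∈₄ =
        s≤s z≤n , s≤s (≤-trans (proj₂ (insertions-bounded r v∈))
          (s≤s (≤-trans (*-monoʳ-≤ (length r) (n≤1+n _)) (m≤n+m _ (length r)))))

tops-count : ∀ (r : Spine s) → length (tops r) ≡ length r * length (subsets s)
tops-count []          = refl
tops-count {s} (_ ∷ r) = trans (length-++ (map _ (subsets s)))
  (cong₂ _+_ (length-map _ (subsets s)) (trans (length-map _ (tops r)) (tops-count r)))

insertions-count : ∀ (r : Spine s) →
  length (insertions r) ≡ length r * (length (subsets s) + length (subsets s))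
insertions-count []                = refl
insertions-count {s} ((g , ρ) ∷ r) = trans (length-++ (map _ (subsets s)))
  (trans (cong₂ _+_ (length-map _ (subsets s)) (trans (length-++ (map _ (subsets s)))
    (cong₂ _+_ (length-map _ (subsets s)) (trans (length-map _ (insertions r)) (insertions-count r)))))
  (sym (+-assoc (length (subsets s)) _ _)))

guarded-length : ∀ (r : Spine s) → length (guarded r) ≤ length r + length r
guarded-length []                = z≤n
guarded-length ((bot , _) ∷ r)    = s≤s (≤-trans (guarded-length r) (+-monoʳ-≤ (length r) (n≤1+n _)))
guarded-length ((conj _ , _) ∷ r) =
  s≤s (≤-trans (s≤s (guarded-length r)) (≤-reflexive (sym (+-suc (length r) (length r)))))

instance-size : ∀ (D : Instance s) → ∥ D ∥ᴵ ≤ length D * s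
instance-size []      = z≤n
instance-size (δ ∷ D) = +-mono-≤ (∣p∣≤n δ) (instance-size D)

sum-size : ∀ {B} {Ds : List (Instance s)} → All (λ D → length D ≤ B) Ds →
           sum (map ∥_∥ᴵ Ds) ≤ length Ds * (B * s)
sum-size []                            = z≤n
sum-size {s} {B} {D ∷ _} (D≤B ∷ Ds≤B) =
  +-mono-≤ (≤-trans (instance-size D) (*-monoˡ-≤ s D≤B)) (sum-size Ds≤B)

guarded-matches : ∀ (r : Spine s) → Matches r (guarded r)
guarded-matches []                = done
guarded-matches ((bot , _) ∷ r)    = take id (guarded-matches r)
guarded-matches ((conj _ , _) ∷ r) = skip id (take id (guarded-matches r))

-- Filtering turns the negative half of fitting into `t′ ⊑ t on negatives t`.
examples : Path s → ExampleSet s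
examples p = record
  { E⁺ = heads t ∷ guarded t ∷ []
  ; E⁻ = filter (¬? ∘ matches? t) (negatives t)
  }
  where t = spine bot p

negatives-bounded : ∀ (t : Spine s) {w} → w ∈ˡ negatives t → 0 < length t →
                    Bounded (length t + length t * length t) w
negatives-bounded t w∈ 0<|t| with ∈-++⁻ (tops t) w∈
... | inj₁ w∈₁ = ≤-trans 0<|t| (≤-reflexive (sym (∈-tops⁻ t w∈₁))) ,
                 ≤-trans (≤-reflexive (∈-tops⁻ t w∈₁)) (m≤m+n _ _)
... | inj₂ w∈₂ with insertions-bounded t w∈₂
...   | 0<|w| , |w|≤ = 0<|w| , ≤-trans |w|≤ (+-monoˡ-≤ _ 0<|t|)

negatives-count : ∀ (t : Spine s) → length (negatives t) ≡ length t * (3 * length (subsets s))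
negatives-count {s} t = trans (length-++ (tops t))
  (trans (cong₂ _+_ (tops-count t) (insertions-count t)) (regroup (length t) (length (subsets s))))
  where
  regroup : ∀ n c → n * c + n * (c + c) ≡ n * (3 * c)
  regroup = solve-∀

-- This is 2Bs + xcBs with B = x + x²: two positive and at most cx negative words, of at most B
-- letters each. The number of subsets is a constant, as s is fixed.
bound : ℕ → Polynomial
bound s = 0 ∷ 2 * s ∷ 2 * s + c * s ∷ c * s ∷ []
  where c = 3 * length (subsets s)

examples-size : ∀ (p : Path s) {x} → length (spine bot p) ≤ x → ∥ examples p ∥ᴱ ≤ eval (bound s) x
examples-size {s} p {x} |t|≤x = begin
  sum (map ∥_∥ᴵ (E⁺ E)) + sum (map ∥_∥ᴵ (E⁻ E))
    ≤⟨ +-mono-≤ (sum-size {B = B} positive) (sum-size {B = B} negative) ⟩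
  2 * (B * s) + length (E⁻ E) * (B * s)
    ≤⟨ +-monoʳ-≤ (2 * (B * s)) (*-monoˡ-≤ (B * s) count) ⟩
  2 * (B * s) + x * c * (B * s)
    ≡⟨ expand x c s ⟩
  eval (bound s) x ∎
  where
  open ≤-Reasoning
  t = spine bot p
  E = examples p
  c = 3 * length (subsets s)
  B = x + x * x
  -- For x ≥ 1 the `guarded` word has at most 2x ≤ x + x² letters.
  instance
    x≢0 : NonZero x
    x≢0 = >-nonZero (≤-trans (s≤s z≤n) |t|≤x)
  positive : All (λ D → length D ≤ B) (E⁺ E)
  positive =
    ≤-trans (≤-reflexive (length-map proj₂ t)) (≤-trans |t|≤x (m≤m+n x (x * x))) ∷
    ≤-trans (guarded-length t) (+-mono-≤ |t|≤x (≤-trans |t|≤x (m≤m*n x x))) ∷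
    []
  negative : All (λ D → length D ≤ B) (E⁻ E)
  negative = All.tabulate λ w∈ →
    ≤-trans (proj₂ (negatives-bounded t (proj₁ (∈-filter⁻ (¬? ∘ matches? t) w∈)) (s≤s z≤n)))
            (+-mono-≤ |t|≤x (*-mono-≤ |t|≤x |t|≤x))
  count : length (E⁻ E) ≤ x * c
  count = ≤-trans (length-filter (¬? ∘ matches? t) (negatives t))
    (≤-trans (≤-reflexive (negatives-count t)) (*-monoˡ-≤ c |t|≤x))
  expand : ∀ x c s → 2 * ((x + x * x) * s) + x * c * ((x + x * x) * s)
                   ≡ 0 + x * (2 * s + x * ((2 * s + c * s) + x * (c * s + x * 0)))
  expand = solve-∀

-- Fitting and unique characterisation

⊨⇒matches′ : ∀ (p : Path s) {w} → Proper p → 0 < length w → w , 0 ⊨ query p → Matches (spine bot p) w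
⊨⇒matches′ p {_ ∷ _} proper _ = ⊨⇒matches p proper

matches⇒⊨′ : ∀ (p : Path s) {w} → Matches (spine bot p) w → w , 0 ⊨ query p
matches⇒⊨′ p {_ ∷ _} = matches⇒⊨ p

examples-fit : ∀ (p : Path s) → Proper p → Fits (query p) (examples p)
examples-fit p proper =
  matches⇒⊨′ p (matches-heads (Pointwise.refl refl)) ∷ matches⇒⊨′ p (guarded-matches t) ∷ [] ,
  All.tabulate λ w∈ h →
    let w∈negatives , ¬m = ∈-filter⁻ (¬? ∘ matches? t) w∈
    in ¬m (⊨⇒matches′ p proper (proj₁ (negatives-bounded t w∈negatives (s≤s z≤n))) h)
  where t = spine bot p

examples-characterise : ∀ (p p′ : Path s) → Proper p → Proper p′ → Peerless (rest p) →
                        Fits (query p′) (examples p) → query p ≣ query p′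
examples-characterise p p′ proper proper′ peers (h ∷ h′ ∷ [] , negative) D ℓ =
  mk⇔ (⊑⇒⊨ p p′ proper t⊑t′) (⊑⇒⊨ p′ p proper′ t′⊑t)
  where
  t  = spine bot p
  t′ = spine bot p′
  agree : t′ ⊑ t on negatives t
  agree {w} w∈ m with matches? t w
  ... | yes m′ = m′
  ... | no ¬m  = ⊥-elim (All.lookup negative (∈-filter⁺ (¬? ∘ matches? t) w∈ ¬m) (matches⇒⊨′ p′ m))
  inclusions = characterised (proper⇒last p proper) (tt ∷ peers)
    (⊨⇒matches p′ proper′ h) (⊨⇒matches p′ proper′ h′) agree
  t⊑t′ : t ⊑ t′
  t⊑t′ = proj₁ inclusions
  t′⊑t : t′ ⊑ t
  t′⊑t = proj₂ inclusions

normalise-≣ : ∀ (p : Path s) → query p ≣ query (normalise p)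
normalise-≣ p D ℓ = mk⇔ (normalise-⊨ p) (normalise-⊨⁻ p)

fits-resp-≣ : ∀ {q q′ : Query s} {E} → q ≣ q′ → Fits q E → Fits q′ E
fits-resp-≣ q≣q′ (pos , neg) =
  All.map (λ {D} → Equivalence.to (q≣q′ D 0)) pos ,
  All.map (λ {D} ¬h → ¬h ∘ Equivalence.from (q≣q′ D 0)) neg

≣-sym : ∀ {q q′ : Query s} → q ≣ q′ → q′ ≣ q
≣-sym q≣q′ D ℓ = ⇔-sym (q≣q′ D ℓ)

theorem14 : (s : ℕ) .{{_ : NonZero s}} → PolynomiallyCharacterisable (𝒫[U] s) (𝒬ₚ[U] s)
theorem14 s = bound s , λ { _ (p , peerless , refl) →
  -- The examples come from the normal form, and every competing path is normalised before the
  -- comparison.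
  let p₀ = normalise p
      E  = examples p₀
  in E ,
     ( fits-resp-≣ {E = E} (≣-sym (normalise-≣ p)) (examples-fit p₀ (normalise-proper p))
     , λ { _ (p′ , refl) fits D ℓ →
         let p₀′ = normalise p′
             p₀≣p₀′ = examples-characterise p₀ p₀′ (normalise-proper p) (normalise-proper p′)
                        (normalise-peerless p peerless) (fits-resp-≣ {E = E} (normalise-≣ p′) fits)
         in ⇔-trans (normalise-≣ p D ℓ) (⇔-trans (p₀≣p₀′ D ℓ) (≣-sym (normalise-≣ p′) D ℓ)) }
     ) ,
     examples-size p₀ (normalise-length p) }
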